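{- Let $G$ be a cubic graph. If $G$ has a $1$-factor, then $\zeta_4(G)=1$. Otherwise, $\zeta_4(G)=2$.
   Context: Graphs are finite and loopless, but may have multiple edges; they need not be connected. A cubic graph is a $3$-regular graph. A $1$-factor is a spanning $1$-regular subgraph (perfect matching). For a non-trivial abelian group $\mathbb{A}$ (written additively, identity $0$), a graph $G$ is zero-sum $\mathbb{A}$-magic if there is a function $\phi: E(G)\to \mathbb{A}\setminus\{0\}$ such that for every vertex $v$ the sum of $\phi(e)$ over all edges $e$ incident to $v$ is $0$. $\mathbb{Z}_n$ is the group of integers modulo $n$, and $\mathbb{Z}_n^k$ is the direct product of $k$ copies of it. For $j\ge 1$, $\zeta_{2j}(G)$ is the smallest positive integer $c$ such that $G$ is zero-sum $\mathbb{Z}_{2j}^c$-magic if such $c$ exists, and $\infty$ otherwise. In particular $\zeta_4(G)$ refers to the groups $\mathbb{Z}_4^c$. -}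

module Defs where

open import Algebra.Bundles using (AbelianGroup)
import Algebra.Construct.Pointwise as Pointwise
open import Data.Fin.Base using (Fin)
open import Data.Fin.Properties using () renaming (_≟_ to _≟ᶠ_)
open import Data.Fin.Subset using (Subset)
open import Data.Fin.Subset.Properties using (_∈?_)
open import Data.Integer.Base using (ℤ; +_; 0ℤ; _+_; _-_; -_)
open import Data.Integer.Divisibility.Signed
  using (_∣_; divides; ∣m⇒∣-m; ∣m∣n⇒∣m+n)
import Data.Integer.Properties as ℤ
open import Data.Integer.Solver using (module +-*-Solver)
open import Data.List.Base using (List; allFin; filter; foldr; length; map)
open import Data.Nat.Base as ℕ using (ℕ; NonZero)
open import Data.Nat.Properties using (≤-antisym)
open import Data.Product.Base using (_×_; _,_; proj₁; proj₂; ∃-syntax)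
open import Data.Empty using (⊥-elim)
open import Data.Sum.Base using (_⊎_)
open import Level using (0ℓ; _⊔_)
open import Relation.Binary.PropositionalEquality
  using (_≡_; _≢_; refl; cong; subst)
open import Relation.Nullary.Construct.Add.Supremum using (_⁺; [_]; ⊤⁺)
open import Relation.Nullary.Decidable using (Dec; _⊎-dec_)
open import Relation.Nullary.Negation using (¬_)

-- A finite loopless multigraph: distinct edges may have the same ends.
-- The order in which the two ends of an edge are listed carries no meaning;
-- everything below depends on `ends` only through `Incident`.
record Graph : Set where
  field
    #V : ℕ
    #E : ℕ

  Vertex : Set
  Vertex = Fin #V

  Edge : Set
  Edge = Fin #E

  field
    ends     : Edge → Vertex × Vertex
    loopless : ∀ e → proj₁ (ends e) ≢ proj₂ (ends e)

  Incident : Vertex → Edge → Set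
  Incident v e = v ≡ proj₁ (ends e) ⊎ v ≡ proj₂ (ends e)

  incident? : ∀ v e → Dec (Incident v e)
  incident? v e = (v ≟ᶠ proj₁ (ends e)) ⊎-dec (v ≟ᶠ proj₂ (ends e))

  edgesAt : Vertex → List Edge
  edgesAt v = filter (incident? v) (allFin #E)

  degree : Vertex → ℕ
  degree v = length (edgesAt v)

  -- A spanning subgraph has all the vertices, so it is given by its edge set.
  SpanningSubgraph : Set
  SpanningSubgraph = Subset #E

  degreeIn : SpanningSubgraph → Vertex → ℕ
  degreeIn F v = length (filter (_∈? F) (edgesAt v))

open Graph public

Cubic : Graph → Set
Cubic G = ∀ v → degree G v ≡ 3

IsOneFactor : (G : Graph) → SpanningSubgraph G → Set
IsOneFactor G F = ∀ v → degreeIn G F v ≡ 1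

HasOneFactor : Graph → Set
HasOneFactor G = ∃[ F ] IsOneFactor G F

ZeroSumMagic : ∀ {a ℓ} → AbelianGroup a ℓ → Graph → Set (a ⊔ ℓ)
ZeroSumMagic A G =
  ∃[ φ ] (∀ (e : Edge G) → ¬ (φ e ≈ ε))
       × (∀ (v : Vertex G) → foldr _∙_ ε (map φ (edgesAt G v)) ≈ ε)
  where open AbelianGroup A

-- The integers modulo n, as the setoid quotient of ℤ by congruence modulo n.
ℤmod : ℕ → AbelianGroup 0ℓ 0ℓ
ℤmod n = record
  { Carrier = ℤ
  ; _≈_     = _≈_
  ; _∙_     = _+_
  ; ε       = 0ℤ
  ; _⁻¹     = -_
  ; isAbelianGroup = record
    { isGroup = record
      { isMonoid = record
        { isSemigroup = record
          { isMagma = record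
            { isEquivalence = record
              { refl  = λ {x} → reflexive {x} refl
              ; sym   = λ {x} {y} p →
                  subst (+ n ∣_) (neg-minus x y) (∣m⇒∣-m p)
              ; trans = λ {x} {y} {z} p q →
                  subst (+ n ∣_) (ℤ.+-minus-telescope x y z) (∣m∣n⇒∣m+n p q)
              }
            ; ∙-cong = λ {x} {y} {u} {v} p q →
                subst (+ n ∣_) (plus-minus x y u v) (∣m∣n⇒∣m+n p q)
            }
          ; assoc = λ x y z → reflexive (ℤ.+-assoc x y z)
          }
        ; identity = (λ x → reflexive (ℤ.+-identityˡ x))
                   , (λ x → reflexive (ℤ.+-identityʳ x))
        }
      ; inverse = (λ x → reflexive (ℤ.+-inverseˡ x))
                , (λ x → reflexive (ℤ.+-inverseʳ x))
      ; ⁻¹-cong = λ {x} {y} p →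
          subst (+ n ∣_) (neg-cong x y) (∣m⇒∣-m p)
      }
    ; comm = λ x y → reflexive (ℤ.+-comm x y)
    }
  }
  where
  open +-*-Solver using (solve; _:+_; _:-_; :-_; _:=_)

  _≈_ : ℤ → ℤ → Set
  x ≈ y = + n ∣ x - y

  reflexive : ∀ {x y} → x ≡ y → x ≈ y
  reflexive {x} refl = divides 0ℤ (ℤ.+-inverseʳ x)

  neg-minus : ∀ x y → - (x - y) ≡ y - x
  neg-minus = solve 2 (λ x y → :- (x :- y) := y :- x) refl

  neg-cong : ∀ x y → - (x - y) ≡ - x - - y
  neg-cong = solve 2 (λ x y → :- (x :- y) := :- x :- :- y) refl

  plus-minus : ∀ x y u v → (x - y) + (u - v) ≡ (x + u) - (y + v)
  plus-minus =
    solve 4 (λ x y u v → (x :- y) :+ (u :- v) := (x :+ u) :- (y :+ v)) refl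

ℤmod_^_ : ℕ → ℕ → AbelianGroup 0ℓ 0ℓ
ℤmod n ^ k = Pointwise.abelianGroup (Fin k) (ℤmod n)

-- `Zeta j G x` says that ζ₂ⱼ(G) = x, where ⊤⁺ stands for ∞.  It is a relation
-- because deciding between the two cases of the definition of ζ₂ⱼ involves
-- an unbounded search over c.
Zeta : (j : ℕ) .{{_ : NonZero j}} → Graph → ℕ ⁺ → Set
Zeta j G [ c ] =
    1 ℕ.≤ c
  × ZeroSumMagic (ℤmod (2 ℕ.* j) ^ c) G
  × (∀ d → 1 ℕ.≤ d → ZeroSumMagic (ℤmod (2 ℕ.* j) ^ d) G → c ℕ.≤ d)
Zeta j G ⊤⁺ = ∀ d → 1 ℕ.≤ d → ¬ ZeroSumMagic (ℤmod (2 ℕ.* j) ^ d) G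

Zeta-unique : ∀ j .{{_ : NonZero j}} (G : Graph) {x y} →
              Zeta j G x → Zeta j G y → x ≡ y
Zeta-unique j G {[ c ]} {[ d ]} (1≤c , C , c-min) (1≤d , D , d-min) =
  cong [_] (≤-antisym (c-min d 1≤d D) (d-min c 1≤c C))
Zeta-unique j G {[ c ]} {⊤⁺} (1≤c , C , _) none = ⊥-elim (none c 1≤c C)
Zeta-unique j G {⊤⁺} {[ d ]} none (1≤d , D , _) = ⊥-elim (none d 1≤d D)
Zeta-unique j G {⊤⁺} {⊤⁺} _ _ = refl

{-# OPTIONS --safe #-}
module Submission where

-- Mod 4, three non-zero elements sum to 0 only if exactly one of them is 2, so
-- ℤ₄-labellings are 1-factors (labelled 2) with the other edges labelled ±1.
--
-- For ℤ₄², the bipartite double cover of G is a 3-regular bipartite multigraph,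
-- so by König it has a proper 3-edge-colouring.  Give a colour j the weight whose
-- i-th coordinate is 2 if i = j and −1 otherwise, and label an edge of G by the
-- sum of the weights of its two lifts.  Around a vertex of G the outgoing lifts
-- have all three colours, and so do the incoming ones, so the labels sum to 0.
-- The i-th coordinate of a label is −2, 1 or 4, and it is 4 only if both lifts
-- have colour i, so it cannot be 4 in both coordinates.
--
-- König's theorem: to colour a further edge whose ends miss the colours α and β
-- respectively, recolour it together with all the edges of colours α and β,
-- which have maximum degree 2.

open import Defs
open import Algebra.Bundles using (AbelianGroup)
open import Data.Bool.Base using (Bool; true; false; not; if_then_else_)
import Data.Bool.Properties as Bool
open import Data.Fin.Base using (Fin; zero; suc; toℕ; fromℕ<)
open import Data.Fin.Patterns using (2F)
import Data.Fin.Properties as Fin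
import Data.Fin.Subset as Subset
import Data.Fin.Subset.Properties as Subset
open import Data.Integer.Base using (ℤ; +_; -1ℤ; 0ℤ; _+_; _-_; _*_)
open import Data.Integer.DivMod using (_%ℕ_; _/ℕ_; n%ℕd<d; a≡a%ℕn+[a/ℕn]*n)
open import Data.Integer.Divisibility.Signed using (_∣?_; divides)
import Data.Integer.Properties as ℤ
open import Data.Integer.Solver using (module +-*-Solver)
open import Data.List.Base
  using (List; []; _∷_; allFin; cartesianProduct; filter; foldr; length; lookup; map)
import Data.List.Membership.DecPropositional as DecMembership
open import Data.List.Membership.Propositional using (_∈_; _∉_; find; lose)
open import Data.List.Membership.Propositional.Properties
  using (∈-allFin; ∈-cartesianProduct⁺; ∈-filter⁺; ∈-filter⁻)
open import Data.List.Properties using (filter-≐; length-filter)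
open import Data.List.Relation.Unary.All using (All; []; _∷_)
open import Data.List.Relation.Unary.All.Properties using (all-filter)
open import Data.List.Relation.Unary.AllPairs using ([]; _∷_)
open import Data.List.Relation.Unary.Any using (Any; here; there; any?; index)
open import Data.List.Relation.Unary.Any.Properties using (lookup-index)
open import Data.List.Relation.Unary.Unique.Propositional using (Unique)
open import Data.List.Relation.Unary.Unique.Propositional.Properties using (allFin⁺; filter⁺)
open import Data.Nat.Base as ℕ using (ℕ; zero; suc; _≤_; z≤n; s≤s)
import Data.Nat.Properties as ℕ
open import Data.Product.Base using (_×_; _,_; proj₁; proj₂; ∃-syntax)
open import Data.Product.Properties using (≡-dec)
open import Data.Sum.Base using (_⊎_; inj₁; inj₂)
open import Data.Vec.Base using (tabulate)
open import Data.Vec.Properties using (lookup∘tabulate; lookup⇒[]=; []=⇒lookup)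
open import Function.Base using (_∘_; const; id)
open import Function.Definitions using (Injective)
open import Relation.Binary.Definitions using (DecidableEquality)
open import Relation.Binary.PropositionalEquality
open import Relation.Nullary.Construct.Add.Supremum using ([_])
open import Relation.Nullary.Decidable
  using (Dec; yes; no; does; _×-dec_; _⊎-dec_; _→-dec_; ¬?; from-yes; dec-true)
open import Relation.Nullary.Negation using (¬_; contradiction)

-- Edge-colourings of bipartite multigraphs.

-- A bipartite multigraph is given by its set D of edges and two maps s, t : D → V
-- to the ends in the two classes; the notions below concern one class at a time.
module EdgeColouring {D V : Set} (_≟ᴰ_ : DecidableEquality D) (_≟ⱽ_ : DecidableEquality V) where

  open DecMembership _≟ᴰ_ using (_∈?_)

  Proper : {C : Set} → (D → V) → (D → C) → List D → Set
  Proper s c L = ∀ {x y} → x ∈ L → y ∈ L → s x ≡ s y → c x ≡ c y → x ≡ y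

  -- A coincidence condition instead of a count: repeated entries of `L` do no harm, and it passes
  -- directly to sublists and along injective renamings.
  MaxDegree2 : (D → V) → List D → Set
  MaxDegree2 s L = ∀ {x y z} → x ∈ L → y ∈ L → z ∈ L →
    s x ≡ s y → s x ≡ s z → x ≡ y ⊎ x ≡ z ⊎ y ≡ z

  MaxDegree : ℕ → (D → V) → Set
  MaxDegree k s = ∀ v (f : Fin (suc k) → D) → (∀ i → s (f i) ≡ v) → ¬ Injective _≡_ _≡_ f

  Missing : {C : Set} → (D → V) → (D → C) → List D → D → C → Set
  Missing s c L d k = ∀ {x} → x ∈ L → s x ≡ s d → c x ≢ k

  update : {A : Set} → (D → A) → D → A → D → A
  update f d a x = if does (x ≟ᴰ d) then a else f x

  update-≡ : {A : Set} (f : D → A) (d : D) (a : A) → update f d a d ≡ a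
  update-≡ f d a with d ≟ᴰ d
  ... | yes _  = refl
  ... | no d≢d = contradiction refl d≢d

  update-≢ : {A : Set} (f : D → A) {d x : D} (a : A) → x ≢ d → update f d a x ≡ f x
  update-≢ f {d} {x} a x≢d with x ≟ᴰ d
  ... | yes x≡d = contradiction x≡d x≢d
  ... | no _    = refl

  ∈-tail : ∀ {x d : D} {L} → x ∈ d ∷ L → x ≢ d → x ∈ L
  ∈-tail (here x≡d) x≢d = contradiction x≡d x≢d
  ∈-tail (there p)  _   = p

  proper-update : {C : Set} {s : D → V} {c : D → C} {L : List D} {d : D} {k : C} →
    Proper s c L → Missing s c L d k → Proper s (update c d k) (d ∷ L)
  proper-update {d = d} proper missing {x} {y} x∈ y∈ sx≡sy cx≡cy with x ≟ᴰ d | y ≟ᴰ d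
  ... | yes refl | yes refl = refl
  ... | yes refl | no y≢d   = contradiction (sym cx≡cy) (missing (∈-tail y∈ y≢d) (sym sx≡sy))
  ... | no x≢d   | yes refl = contradiction cx≡cy (missing (∈-tail x∈ x≢d) sx≡sy)
  ... | no x≢d   | no y≢d   = proper (∈-tail x∈ x≢d) (∈-tail y∈ y≢d) sx≡sy cx≡cy

  proper-∷-∈ : {C : Set} {s : D → V} {c : D → C} {L : List D} {d : D} →
    d ∈ L → Proper s c L → Proper s c (d ∷ L)
  proper-∷-∈ {L = L} {d} d∈L proper x∈ y∈ = proper (drop x∈) (drop y∈)
    where
    drop : ∀ {x} → x ∈ d ∷ L → x ∈ L
    drop (here refl) = d∈L
    drop (there p)   = p

  -- Maximum degree 2: colouring with two colours.

  maxDegree2-∘ : ∀ {s L M} (r : D → D) → (∀ {x} → x ∈ M → r x ∈ L) →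
    (∀ {x y} → x ∈ M → y ∈ M → r x ≡ r y → x ≡ y) →
    MaxDegree2 s L → MaxDegree2 (s ∘ r) M
  maxDegree2-∘ r into inj deg x∈ y∈ z∈ p q with deg (into x∈) (into y∈) (into z∈) p q
  ... | inj₁ e        = inj₁ (inj x∈ y∈ e)
  ... | inj₂ (inj₁ e) = inj₂ (inj₁ (inj x∈ z∈ e))
  ... | inj₂ (inj₂ e) = inj₂ (inj₂ (inj y∈ z∈ e))

  maxDegree2-⊆ : ∀ {s L M} → (∀ {x} → x ∈ M → x ∈ L) → MaxDegree2 s L → MaxDegree2 s M
  maxDegree2-⊆ M⊆L = maxDegree2-∘ id M⊆L (λ _ _ e → e)

  -- Of `d`, `x` and `a`, all at one end, two must coincide, and `d` lies outside `L`.
  unique-neighbour : ∀ {s L a d} → MaxDegree2 s (d ∷ L) → d ∉ L → a ∈ L → s a ≡ s d →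
    ∀ {x} → x ∈ L → s x ≡ s d → x ≡ a
  unique-neighbour {s} deg d∉L a∈L sa≡sd x∈L sx≡sd
    with deg (here refl) (there x∈L) (there a∈L) (sym sx≡sd) (sym sa≡sd)
  ... | inj₁ refl        = contradiction x∈L d∉L
  ... | inj₂ (inj₁ refl) = contradiction a∈L d∉L
  ... | inj₂ (inj₂ x≡a)  = x≡a

  -- At most one edge of `L` shares this end with `d`, so the opposite of its colour is free.
  missing-Bool : ∀ {s L d} → MaxDegree2 s (d ∷ L) → d ∉ L → (χ : D → Bool) →
    ∃[ k ] Missing s χ L d k
  missing-Bool {s} {L} {d} deg d∉L χ with any? (λ x → s x ≟ⱽ s d) L
  ... | no none = true , λ x∈L sx≡sd _ → none (lose x∈L sx≡sd)
  ... | yes some with a , a∈L , sa≡sd ← find some =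
    not (χ a) , λ x∈L sx≡sd → Bool.not-¬ (cong χ (unique-neighbour {s} deg d∉L a∈L sa≡sd x∈L sx≡sd))

  -- If d meets a in s and b in t, then the path a, d, b is contracted to one
  -- edge with the outer ends of b and a, which keeps the name a.
  two-colouring : ∀ n (L : List D) → length L ≤ n → (s t : D → V) →
    MaxDegree2 s L → MaxDegree2 t L → ∃[ χ ] Proper {Bool} s χ L × Proper t χ L
  two-colouring n [] _ s t _ _ = const true , (λ ()) , (λ ())
  two-colouring (suc n) (d ∷ L) (s≤s |L|≤n) s t degₛ degₜ = colour (d ∈? L)
    where
    Colouring : List D → Set
    Colouring M = ∃[ χ ] Proper {Bool} s χ M × Proper t χ M

    colouring-L : Colouring L
    colouring-L = two-colouring n L |L|≤n s t (maxDegree2-⊆ {s} there degₛ) (maxDegree2-⊆ {t} there degₜ)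

    extend : ∀ {χ k} → Proper s χ L → Proper t χ L →
      Missing s χ L d k → Missing t χ L d k → Colouring (d ∷ L)
    extend {χ} {k} properₛ properₜ missingₛ missingₜ =
      update χ d k , proper-update properₛ missingₛ , proper-update properₜ missingₜ

    module _ (d∉L : d ∉ L) {a b : D} (a∈L : a ∈ L) (b∈L : b ∈ L)
             (sa≡sd : s a ≡ s d) (tb≡td : t b ≡ t d) where

      only-a : ∀ {x} → x ∈ L → s x ≡ s d → x ≡ a
      only-a = unique-neighbour {s} degₛ d∉L a∈L sa≡sd

      only-b : ∀ {x} → x ∈ L → t x ≡ t d → x ≡ b
      only-b = unique-neighbour {t} degₜ d∉L b∈L tb≡td

      contracted : a ≢ b → ∃[ χ ] Proper {Bool} s χ L × Proper t χ L × χ a ≡ χ b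
      contracted a≢b = χ′ , properₛ , properₜ , trans χ′a (sym χ′b)
        where
        M : List D
        M = filter (λ x → ¬? (x ≟ᴰ b)) L

        M⇒L : ∀ {x} → x ∈ M → x ∈ L
        M⇒L = proj₁ ∘ ∈-filter⁻ (λ x → ¬? (x ≟ᴰ b))

        M⇒≢b : ∀ {x} → x ∈ M → x ≢ b
        M⇒≢b = proj₂ ∘ ∈-filter⁻ (λ x → ¬? (x ≟ᴰ b)) {xs = L}

        L⇒M : ∀ {x} → x ∈ L → x ≢ b → x ∈ M
        L⇒M = ∈-filter⁺ (λ x → ¬? (x ≟ᴰ b))

        -- The contracted edge `a` keeps its own end in `t` and takes the end of `b` in `s`, so only
        -- `s` is composed with `r`.
        r : D → D
        r = update id a b

        r-into : ∀ {x} → x ∈ M → r x ∈ d ∷ L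
        r-into {x} x∈M with x ≟ᴰ a
        ... | yes _ = there b∈L
        ... | no _  = there (M⇒L x∈M)

        r-injective : ∀ {x y} → x ∈ M → y ∈ M → r x ≡ r y → x ≡ y
        r-injective {x} {y} x∈M y∈M rx≡ry with x ≟ᴰ a | y ≟ᴰ a
        ... | yes x≡a | yes y≡a = trans x≡a (sym y≡a)
        ... | yes _   | no _    = contradiction (sym rx≡ry) (M⇒≢b y∈M)
        ... | no _    | yes _   = contradiction rx≡ry (M⇒≢b x∈M)
        ... | no _    | no _    = rx≡ry

        colouring-M : ∃[ χ ] Proper {Bool} (s ∘ r) χ M × Proper t χ M
        -- The recursion is on the length bound `n`: `M` is a filtered list and not a subterm of
        -- `d ∷ L`.
        colouring-M = two-colouring n M
          (ℕ.≤-trans (length-filter (λ x → ¬? (x ≟ᴰ b)) L) |L|≤n) (s ∘ r) t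
          (maxDegree2-∘ {s} r r-into r-injective degₛ)
          (maxDegree2-⊆ {t} (there ∘ M⇒L) degₜ)

        χ : D → Bool
        χ = proj₁ colouring-M

        χ′ : D → Bool
        χ′ = update χ b (χ a)

        χ′a : χ′ a ≡ χ a
        χ′a = update-≢ χ (χ a) a≢b

        χ′b : χ′ b ≡ χ a
        χ′b = update-≡ χ b (χ a)

        -- At the end `s b` the contracted edge stands for `b` with colour `χ a`, so properness on
        -- `M` excludes any further edge of that colour. If `x` is `a`, then `b` too has the end
        -- `s d`, which forces `b ≡ a`.
        b-alone : ∀ {x} → x ∈ L → s x ≡ s b → χ x ≡ χ a → x ≡ b
        b-alone {x} x∈L sx≡sb χx≡χa with x ≟ᴰ b | x ≟ᴰ a
        ... | yes x≡b | _        = x≡b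
        ... | no _    | yes refl = sym (only-a b∈L (trans (sym sx≡sb) sa≡sd))
        ... | no x≢b  | no x≢a   = contradiction
          (proj₁ (proj₂ colouring-M) (L⇒M x∈L x≢b) (L⇒M a∈L a≢b) (begin
            s (r x) ≡⟨ cong s (update-≢ id b x≢a) ⟩
            s x     ≡⟨ sx≡sb ⟩
            s b     ≡⟨ cong s (update-≡ id a b) ⟨
            s (r a) ∎) χx≡χa) x≢a
          where open ≡-Reasoning

        properₛ : Proper s χ′ L
        properₛ {x} {y} x∈L y∈L sx≡sy χx≡χy with x ≟ᴰ b | y ≟ᴰ b
        ... | yes refl | yes refl = refl
        ... | yes refl | no _ = sym (b-alone y∈L (sym sx≡sy) (sym χx≡χy))
        ... | no _ | yes refl = b-alone x∈L sx≡sy χx≡χy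
        ... | no x≢b | no y≢b with x ≟ᴰ a | y ≟ᴰ a
        -- Within `L`, `a` is alone at its end `s d`, so its colour cannot conflict there.
        ...   | yes refl | _        = sym (only-a y∈L (trans (sym sx≡sy) sa≡sd))
        ...   | no _     | yes refl = only-a x∈L (trans sx≡sy sa≡sd)
        ...   | no x≢a   | no y≢a   = proj₁ (proj₂ colouring-M) (L⇒M x∈L x≢b) (L⇒M y∈L y≢b)
          (subst₂ (λ x y → s x ≡ s y) (sym (update-≢ id b x≢a)) (sym (update-≢ id b y≢a)) sx≡sy)
          χx≡χy

        properₜ : Proper t χ′ L
        properₜ {x} {y} x∈L y∈L tx≡ty χx≡χy with x ≟ᴰ b | y ≟ᴰ b
        ... | yes refl | yes refl = refl
        -- Within `L`, `b` is alone at its end `t d`, so giving it a new colour is safe.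
        ... | yes refl | no _ = sym (only-b y∈L (trans (sym tx≡ty) tb≡td))
        ... | no _ | yes refl = only-b x∈L (trans tx≡ty tb≡td)
        ... | no x≢b | no y≢b = proj₂ (proj₂ colouring-M) (L⇒M x∈L x≢b) (L⇒M y∈L y≢b) tx≡ty χx≡χy

      equal-at-neighbours : ∃[ χ ] Proper {Bool} s χ L × Proper t χ L × χ a ≡ χ b
      equal-at-neighbours with a ≟ᴰ b
      ... | no a≢b   = contracted a≢b
      -- Here `d` is parallel to `a`, and any colouring of `L` will do.
      ... | yes refl with χ , properₛ , properₜ ← colouring-L = χ , properₛ , properₜ , refl

      extend-between : Colouring (d ∷ L)
      extend-between with χ , properₛ , properₜ , χa≡χb ← equal-at-neighbours =
        -- The colour given to `d` is `not (χ a)`: its only neighbours in `L` are `a` and `b`, and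
        -- they agree.
        extend properₛ properₜ
          (λ x∈L sx≡sd → Bool.not-¬ (cong χ (only-a x∈L sx≡sd)))
          (λ x∈L tx≡td → Bool.not-¬ (trans (cong χ (only-b x∈L tx≡td)) (sym χa≡χb)))

    colour : Dec (d ∈ L) → Colouring (d ∷ L)
    colour (yes d∈L) with χ , properₛ , properₜ ← colouring-L =
      χ , proper-∷-∈ d∈L properₛ , proper-∷-∈ d∈L properₜ
    colour (no d∉L) with any? (λ x → s x ≟ⱽ s d) L | any? (λ x → t x ≟ⱽ t d) L
    -- With no neighbour in one class, only the other class restricts the colour of `d`.
    ... | no none | _ with χ , properₛ , properₜ ← colouring-L
        with k , missing ← missing-Bool {t} degₜ d∉L χ =
      extend properₛ properₜ (λ x∈L sx≡sd _ → none (lose x∈L sx≡sd)) missing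
    ... | yes _ | no none with χ , properₛ , properₜ ← colouring-L
        with k , missing ← missing-Bool {s} degₛ d∉L χ =
      extend properₛ properₜ missing (λ x∈L tx≡td _ → none (lose x∈L tx≡td))
    ... | yes p | yes q with a , a∈L , sa≡sd ← find p | b , b∈L , tb≡td ← find q =
      extend-between d∉L a∈L b∈L sa≡sd tb≡td

  -- König's edge-colouring theorem.

  module _ {k : ℕ} where

    -- If all `k` colours occurred at this end, one edge of `L` for each of them together with `d`
    -- would be `k + 1` distinct edges there.
    missing-Fin : ∀ {s L d} → MaxDegree k s → d ∉ L → (c : D → Fin k) →
      ∃[ i ] Missing s c L d i
    missing-Fin {s} {L} {d} deg d∉L c =
      let i , unused = Fin.¬∀⟶∃¬ k Used used? not-all
      in  i , λ x∈L sx≡sd cx≡i → unused (lose x∈L (sx≡sd , cx≡i))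
      where
      Used : Fin k → Set
      Used i = Any (λ x → s x ≡ s d × c x ≡ i) L

      used? : ∀ i → Dec (Used i)
      used? i = any? (λ x → (s x ≟ⱽ s d) ×-dec (c x Fin.≟ i)) L

      not-all : ¬ (∀ i → Used i)
      not-all used = deg (s d) f f-at f-injective
        where
        f : Fin (suc k) → D
        f zero    = d
        f (suc i) = proj₁ (find (used i))

        f∈L : ∀ i → f (suc i) ∈ L
        f∈L i = proj₁ (proj₂ (find (used i)))

        f-at : ∀ i → s (f i) ≡ s d
        f-at zero    = refl
        f-at (suc i) = proj₁ (proj₂ (proj₂ (find (used i))))

        f-colour : ∀ i → c (f (suc i)) ≡ i
        f-colour i = proj₂ (proj₂ (proj₂ (find (used i))))

        f-injective : Injective _≡_ _≡_ f
        f-injective {zero}  {zero}  _ = refl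
        f-injective {zero}  {suc j} e = contradiction (subst (_∈ L) (sym e) (f∈L j)) d∉L
        f-injective {suc i} {zero}  e = contradiction (subst (_∈ L) e (f∈L i)) d∉L
        f-injective {suc i} {suc j} e =
          cong suc (trans (sym (f-colour i)) (trans (cong c e) (f-colour j)))

    -- Two of any three edges share a colour, and at a common end properness identifies them.
    maxDegree2-bicoloured : ∀ {s L} {c : D → Fin k} {α β} → Proper s c L →
      (∀ {x} → x ∈ L → c x ≡ α ⊎ c x ≡ β) → MaxDegree2 s L
    maxDegree2-bicoloured proper col x∈ y∈ z∈ sx≡sy sx≡sz with col x∈ | col y∈ | col z∈
    ... | inj₁ p | inj₁ q | _      = inj₁ (proper x∈ y∈ sx≡sy (trans p (sym q)))
    ... | inj₂ p | inj₂ q | _      = inj₁ (proper x∈ y∈ sx≡sy (trans p (sym q)))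
    ... | inj₁ p | inj₂ _ | inj₁ q = inj₂ (inj₁ (proper x∈ z∈ sx≡sz (trans p (sym q))))
    ... | inj₂ p | inj₁ _ | inj₂ q = inj₂ (inj₁ (proper x∈ z∈ sx≡sz (trans p (sym q))))
    ... | inj₁ _ | inj₂ p | inj₂ q = inj₂ (inj₂ (proper y∈ z∈ (trans (sym sx≡sy) sx≡sz) (trans p (sym q))))
    ... | inj₂ _ | inj₁ p | inj₁ q = inj₂ (inj₂ (proper y∈ z∈ (trans (sym sx≡sy) sx≡sz) (trans p (sym q))))

    module Recolour {s t : D → V} {L : List D} {d : D} {c : D → Fin k} {α β : Fin k}
      (properₛ : Proper s c L) (properₜ : Proper t c L)
      (missingₛ : Missing s c L d α) (missingₜ : Missing t c L d β) (α≢β : α ≢ β) where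

      Active : D → Set
      Active x = x ≡ d ⊎ c x ≡ α ⊎ c x ≡ β

      active? : ∀ x → Dec (Active x)
      active? x = (x ≟ᴰ d) ⊎-dec ((c x Fin.≟ α) ⊎-dec (c x Fin.≟ β))

      M : List D
      M = filter active? (d ∷ L)

      M⇒L : ∀ {x} → x ∈ M → x ∈ d ∷ L
      M⇒L = proj₁ ∘ ∈-filter⁻ active?

      bicoloured : ∀ γ → γ ≡ α ⊎ γ ≡ β → ∀ {x} → x ∈ M →
        update c d γ x ≡ α ⊎ update c d γ x ≡ β
      bicoloured γ γ∈ {x} x∈M with x ≟ᴰ d | proj₂ (∈-filter⁻ active? {xs = d ∷ L} x∈M)
      ... | yes _  | _          = γ∈
      ... | no x≢d | inj₁ x≡d   = contradiction x≡d x≢d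
      ... | no _   | inj₂ cx∈αβ = cx∈αβ

      -- For this bound `d` is given `α`, missing at its end in `s`; for `t` it is given `β`. Each
      -- auxiliary colouring has to be proper in one class only.
      degₛ : MaxDegree2 s M
      degₛ = maxDegree2-bicoloured {s}
        (λ x∈ y∈ → proper-update properₛ missingₛ (M⇒L x∈) (M⇒L y∈))
        (bicoloured α (inj₁ refl))

      degₜ : MaxDegree2 t M
      degₜ = maxDegree2-bicoloured {t}
        (λ x∈ y∈ → proper-update properₜ missingₜ (M⇒L x∈) (M⇒L y∈))
        (bicoloured β (inj₂ refl))

      pick : Bool → Fin k
      pick b = if b then α else β

      pick-injective : ∀ {x y} → pick x ≡ pick y → x ≡ y
      pick-injective {true}  {true}  _ = refl
      pick-injective {true}  {false} e = contradiction e α≢β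
      pick-injective {false} {true}  e = contradiction (sym e) α≢β
      pick-injective {false} {false} _ = refl

      pick-αβ : ∀ b → pick b ≡ α ⊎ pick b ≡ β
      pick-αβ true  = inj₁ refl
      pick-αβ false = inj₂ refl

      module _ (χ : D → Bool) where

        recolour : D → Fin k
        recolour x with active? x
        ... | yes _ = pick (χ x)
        ... | no _  = c x

        outside : ∀ {x b} → ¬ Active x → c x ≢ pick b
        outside {b = b} inactive e with pick-αβ b
        ... | inj₁ p = inactive (inj₂ (inj₁ (trans e p)))
        ... | inj₂ p = inactive (inj₂ (inj₂ (trans e p)))

        -- Active edges get `α` or `β` and inactive ones keep other colours, so a clash could occur
        -- only within one kind: `χ` settles the first, the old colouring the second.
        recolour-proper : ∀ {s} → Proper s c L → Proper s χ M → Proper s recolour (d ∷ L)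
        recolour-proper proper properχ {x} {y} x∈ y∈ sx≡sy e with active? x | active? y
        ... | yes p | yes q = properχ (∈-filter⁺ active? x∈ p) (∈-filter⁺ active? y∈ q)
                                sx≡sy (pick-injective e)
        ... | yes p | no q  = contradiction (sym e) (outside q)
        ... | no p  | yes q = contradiction e (outside p)
        ... | no p  | no q  = proper (∈-tail x∈ (p ∘ inj₁)) (∈-tail y∈ (q ∘ inj₁)) sx≡sy e

      recoloured : ∃[ c′ ] Proper {Fin k} s c′ (d ∷ L) × Proper t c′ (d ∷ L)
      recoloured with χ , pₛ , pₜ ← two-colouring (length M) M ℕ.≤-refl s t degₛ degₜ =
        recolour χ , recolour-proper χ properₛ pₛ , recolour-proper χ properₜ pₜ

    -- Edges are added one at a time; `c₀` serves the empty list, since `Fin k` may itself be empty.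
    könig : ∀ {s t} → MaxDegree k s → MaxDegree k t → (L : List D) →
      (D → Fin k) → ∃[ c ] Proper {Fin k} s c L × Proper t c L
    könig degₛ degₜ [] c₀ = c₀ , (λ ()) , (λ ())
    könig {s} {t} degₛ degₜ (d ∷ L) c₀
      with c , properₛ , properₜ ← könig degₛ degₜ L c₀ | d ∈? L
    ... | yes d∈L = c , proper-∷-∈ d∈L properₛ , proper-∷-∈ d∈L properₜ
    ... | no d∉L
      with α , missingₛ ← missing-Fin degₛ d∉L c | β , missingₜ ← missing-Fin degₜ d∉L c
      with α Fin.≟ β
    ...   | yes refl = update c d α , proper-update properₛ missingₛ , proper-update properₜ missingₜ
    ...   | no α≢β   = Recolour.recoloured properₛ properₜ missingₛ missingₜ α≢β

-- The weights of the three colours.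

module ℤ₄ = AbelianGroup (ℤmod 4)

weight : Fin 3 → Fin 2 → ℤ
weight zero          zero    = + 2
weight (suc zero)    (suc _) = + 2
weight _             _       = -1ℤ

-- In each coordinate one colour has weight 2 and the other two have -1, so the sum vanishes already
-- in ℤ.
weight-sum : ∀ a b c → a ≢ b → a ≢ c → b ≢ c → ∀ i →
  weight a i + (weight b i + weight c i) ≡ 0ℤ
weight-sum = from-yes (Fin.all? λ a → Fin.all? λ b → Fin.all? λ c →
  ¬? (a Fin.≟ b) →-dec ¬? (a Fin.≟ c) →-dec ¬? (b Fin.≟ c) →-dec Fin.all? λ i →
  weight a i + (weight b i + weight c i) ℤ.≟ 0ℤ)

weight-nonzero : ∀ a b → ¬ (∀ i → weight a i + weight b i ℤ₄.≈ 0ℤ)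
weight-nonzero = from-yes (Fin.all? λ a → Fin.all? λ b → ¬? (Fin.all? λ i →
  + 4 ∣? (weight a i + weight b i - 0ℤ)))

-- The bipartite double cover.

module Darts (G : Graph) where

  -- The darts are the edges of the bipartite double cover of G.
  Dart : Set
  Dart = Edge G × Bool

  reverse : Dart → Dart
  reverse (e , b) = e , not b

  -- The two classes of the double cover are copies of the vertex set: `source` is the end in the
  -- first, `target` the end in the second.
  source target : Dart → Vertex G
  source (e , true)  = proj₁ (ends G e)
  source (e , false) = proj₂ (ends G e)
  target = source ∘ reverse

  reverse-involutive : ∀ d → reverse (reverse d) ≡ d
  reverse-involutive (e , b) = cong (e ,_) (Bool.not-involutive b)

  -- As there are no loops, the two darts over an edge differ in their source.
  dart-≡ : ∀ {d d′} → proj₁ d ≡ proj₁ d′ → source d ≡ source d′ → d ≡ d′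
  dart-≡ {_ , true}  {_ , true}  refl _ = refl
  dart-≡ {e , true}  {_ , false} refl p = contradiction p (loopless G e)
  dart-≡ {e , false} {_ , true}  refl p = contradiction (sym p) (loopless G e)
  dart-≡ {_ , false} {_ , false} refl _ = refl

  source-incident : ∀ d → Incident G (source d) (proj₁ d)
  source-incident (_ , true)  = inj₁ refl
  source-incident (_ , false) = inj₂ refl

  dart-from : ∀ {v e} → Incident G v e → ∃[ b ] source (e , b) ≡ v
  dart-from (inj₁ p) = true , sym p
  dart-from (inj₂ p) = false , sym p

  ∈-edgesAt : ∀ {v} d → source d ≡ v → proj₁ d ∈ edgesAt G v
  ∈-edgesAt d refl = ∈-filter⁺ (incident? G _) (∈-allFin _) (source-incident d)

  open EdgeColouring (≡-dec (Fin._≟_ {#E G}) Bool._≟_) (Fin._≟_ {#V G})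

  -- Distinct darts leaving `v` lie over distinct edges, so `k + 1` of them would need `k + 1`
  -- positions in the list `edgesAt G v` of length `k`.
  maxDegree-source : ∀ {k} → (∀ v → degree G v ≡ k) → MaxDegree k source
  maxDegree-source {k} deg v f f-at f-injective =
    let i , j , i<j , eq = Fin.pigeonhole (ℕ.≤-reflexive (cong suc (deg v))) position
    in  ℕ.<⇒≢ i<j (cong toℕ (f-injective (dart-≡ (edge-≡ i j eq) (trans (f-at i) (sym (f-at j))))))
    where
    edge∈ : ∀ i → proj₁ (f i) ∈ edgesAt G v
    edge∈ i = ∈-edgesAt (f i) (f-at i)

    position : Fin (suc k) → Fin (degree G v)
    position i = index (edge∈ i)

    edge-≡ : ∀ i j → position i ≡ position j → proj₁ (f i) ≡ proj₁ (f j)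
    edge-≡ i j eq = trans (lookup-index (edge∈ i))
      (trans (cong (lookup (edgesAt G v)) eq) (sym (lookup-index (edge∈ j))))

  maxDegree-target : ∀ {k} → (∀ v → degree G v ≡ k) → MaxDegree k target
  maxDegree-target deg v f f-at f-injective =
    maxDegree-source deg v (reverse ∘ f) f-at λ {i} {j} p → f-injective
      (trans (sym (reverse-involutive (f i))) (trans (cong reverse p) (reverse-involutive (f j))))

  -- The degree has the form `suc k` so that the colour `zero` exists to start from. All darts are
  -- listed, so properness holds without membership conditions.
  dart-colouring : ∀ {k} → (∀ v → degree G v ≡ suc k) → ∃[ c ]
    (∀ {d d′} → source d ≡ source d′ → c d ≡ c d′ → d ≡ d′) ×
    (∀ {d d′} → target d ≡ target d′ → c d ≡ c d′ → d ≡ d′)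
  dart-colouring {k} deg
    with c , properₛ , properₜ ← könig {suc k} (maxDegree-source deg) (maxDegree-target deg)
           (cartesianProduct (allFin (#E G)) (true ∷ false ∷ [])) (const zero)
    = c , properₛ (∈-darts _) (∈-darts _) , properₜ (∈-darts _) (∈-darts _)
    where
    ∈-darts : ∀ d → d ∈ cartesianProduct (allFin (#E G)) (true ∷ false ∷ [])
    ∈-darts (e , true)  = ∈-cartesianProduct⁺ (∈-allFin e) (here refl)
    ∈-darts (e , false) = ∈-cartesianProduct⁺ (∈-allFin e) (there (here refl))

-- Labelling a cubic graph in ℤ₄².

cubic⇒ℤ₄²-magic : ∀ G → Cubic G → ZeroSumMagic (ℤmod 4 ^ 2) G
cubic⇒ℤ₄²-magic G cubic = φ , (λ e → weight-nonzero (c (e , true)) (c (e , false))) , λ v i →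
  ℤ₄.reflexive (vertex-sum v i (edgesAt G v) (cubic v)
    (filter⁺ (incident? G v) (allFin⁺ (#E G))) (all-filter (incident? G v) (allFin (#E G))))
  where
  open Darts G

  c : Dart → Fin 3
  c = proj₁ (dart-colouring cubic)

  φ : Edge G → Fin 2 → ℤ
  φ e i = weight (c (e , true)) i + weight (c (e , false)) i

  -- Reads the label from the end `source (e , b)`: the lift leaving it comes first, the lift
  -- entering it second.
  φ-directed : ∀ e b i → φ e i ≡ weight (c (e , b)) i + weight (c (e , not b)) i
  φ-directed e true  i = refl
  φ-directed e false i = ℤ.+-comm (weight (c (e , true)) i) _

  out-≢ : ∀ {v e e′ b b′} → source (e , b) ≡ v → source (e′ , b′) ≡ v → e ≢ e′ →
    c (e , b) ≢ c (e′ , b′)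
  out-≢ p p′ e≢e′ eq =
    e≢e′ (cong proj₁ (proj₁ (proj₂ (dart-colouring cubic)) (trans p (sym p′)) eq))

  in-≢ : ∀ {v e e′ b b′} → source (e , b) ≡ v → source (e′ , b′) ≡ v → e ≢ e′ →
    c (e , not b) ≢ c (e′ , not b′)
  in-≢ {e = e} {e′} {b} {b′} p p′ e≢e′ eq = e≢e′ (cong proj₁ (proj₂ (proj₂ (dart-colouring cubic))
    (trans (cong source (reverse-involutive (e , b)))
      (trans (trans p (sym p′)) (cong source (sym (reverse-involutive (e′ , b′))))))
    eq))

  rearrange : ∀ a a′ b b′ c c′ →
    (a + a′) + ((b + b′) + ((c + c′) + 0ℤ)) ≡ (a + (b + c)) + (a′ + (b′ + c′))
  rearrange = solve 6 (λ a a′ b b′ c c′ →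
    (a :+ a′) :+ ((b :+ b′) :+ ((c :+ c′) :+ con 0ℤ)) := (a :+ (b :+ c)) :+ (a′ :+ (b′ :+ c′))) refl
    where open +-*-Solver

  vertex-sum : ∀ v i es → length es ≡ 3 → Unique es → All (Incident G v) es →
    foldr (AbelianGroup._∙_ (ℤmod 4 ^ 2)) (AbelianGroup.ε (ℤmod 4 ^ 2)) (map φ es) i ≡ 0ℤ
  vertex-sum v i (e₁ ∷ e₂ ∷ e₃ ∷ []) refl
    ((≢₁₂ ∷ ≢₁₃ ∷ []) ∷ (≢₂₃ ∷ []) ∷ _) (inc₁ ∷ inc₂ ∷ inc₃ ∷ [])
    with b₁ , p₁ ← dart-from inc₁ | b₂ , p₂ ← dart-from inc₂ | b₃ , p₃ ← dart-from inc₃ = begin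
      φ e₁ i + (φ e₂ i + (φ e₃ i + 0ℤ))
        ≡⟨ cong₂ _+_ (φ-directed e₁ b₁ i)
             (cong₂ _+_ (φ-directed e₂ b₂ i) (cong (_+ 0ℤ) (φ-directed e₃ b₃ i))) ⟩
      _
        -- Separates the outgoing lifts at `v` from the incoming ones.
        ≡⟨ rearrange (weight (c (e₁ , b₁)) i) _ (weight (c (e₂ , b₂)) i) _ (weight (c (e₃ , b₃)) i) _ ⟩
      _
        ≡⟨ cong₂ _+_
             (weight-sum _ _ _ (out-≢ p₁ p₂ ≢₁₂) (out-≢ p₁ p₃ ≢₁₃) (out-≢ p₂ p₃ ≢₂₃) i)
             (weight-sum _ _ _ (in-≢ p₁ p₂ ≢₁₂) (in-≢ p₁ p₃ ≢₁₃) (in-≢ p₂ p₃ ≢₂₃) i) ⟩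
      0ℤ ∎
    where open ≡-Reasoning

-- From 1-factors to labellings in ℤ₄.

module _ {E : Set} {P : E → Set} (P? : ∀ e → Dec (P e)) where

  oneFactorLabel : E → Fin 1 → ℤ
  oneFactorLabel e _ = if does (P? e) then + 2 else + 1

  oneFactorLabel-nonzero : ∀ e → ¬ (∀ i → oneFactorLabel e i ℤ₄.≈ 0ℤ)
  oneFactorLabel-nonzero e with P? e
  ... | yes _ = from-yes (¬? (Fin.all? {1} λ i → + 4 ∣? + 2))
  ... | no _  = from-yes (¬? (Fin.all? {1} λ i → + 4 ∣? + 1))

  -- A label is 1, with 1 more on a chosen edge. For a 1-factor of a cubic graph the sum at a vertex
  -- is thus 3 + 1 = 4.
  oneFactorLabel-sum : ∀ i es →
    foldr (AbelianGroup._∙_ (ℤmod 4 ^ 1)) (AbelianGroup.ε (ℤmod 4 ^ 1))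
      (map oneFactorLabel es) i ≡ + (length es ℕ.+ length (filter P? es))
  oneFactorLabel-sum i [] = refl
  oneFactorLabel-sum i (e ∷ es) with does (P? e)
  ... | true  = trans (cong (λ n → + 2 + n) (oneFactorLabel-sum i es))
                  (cong (λ n → + suc n) (sym (ℕ.+-suc (length es) _)))
  ... | false = cong (λ n → + 1 + n) (oneFactorLabel-sum i es)

oneFactor⇒ℤ₄-magic : ∀ G → Cubic G → HasOneFactor G → ZeroSumMagic (ℤmod 4 ^ 1) G
oneFactor⇒ℤ₄-magic G cubic (F , factor) =
    oneFactorLabel (Subset._∈? F)
  , oneFactorLabel-nonzero (Subset._∈? F)
  , λ v i → subst (ℤ₄._≈ 0ℤ)
      (sym (trans (oneFactorLabel-sum (Subset._∈? F) i (edgesAt G v))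
        (cong₂ (λ m n → + (m ℕ.+ n)) (cubic v) (factor v))))
      (divides (+ 1) refl)

-- From labellings in ℤ₄ to 1-factors.

residue : ℤ → Fin 4
residue x = fromℕ< (n%ℕd<d x 4)

residue-≈ : ∀ x → x ℤ₄.≈ + toℕ (residue x)
residue-≈ x = divides (x /ℕ 4) (begin
  x - + toℕ (residue x)                  ≡⟨ cong (λ r → x - + r) (Fin.toℕ-fromℕ< (n%ℕd<d x 4)) ⟩
  x - r                                  ≡⟨ cong (_- r) (a≡a%ℕn+[a/ℕn]*n x 4) ⟩
  (r + (x /ℕ 4) * + 4) - r
    ≡⟨ solve 2 (λ a b → (a :+ b) :- a := b) refl r ((x /ℕ 4) * + 4) ⟩
  (x /ℕ 4) * + 4 ∎)
  where
  open ≡-Reasoning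
  open +-*-Solver
  r = + (x %ℕ 4)

≡2? : (r : Fin 4) → Dec (r ≡ 2F)
≡2? r = r Fin.≟ 2F

-- The number of odd residues is even, so one or three of the residues are 2, and three would give
-- 6, which is not 0 modulo 4. The code checks all triples by evaluation.
residues-one-2 : ∀ (r₁ r₂ r₃ : Fin 4) → r₁ ≢ zero → r₂ ≢ zero → r₃ ≢ zero →
  + toℕ r₁ + (+ toℕ r₂ + (+ toℕ r₃ + 0ℤ)) ℤ₄.≈ 0ℤ →
  length (filter ≡2? (r₁ ∷ r₂ ∷ r₃ ∷ [])) ≡ 1
residues-one-2 = from-yes (Fin.all? λ r₁ → Fin.all? λ r₂ → Fin.all? λ r₃ →
  ¬? (r₁ Fin.≟ zero) →-dec ¬? (r₂ Fin.≟ zero) →-dec ¬? (r₃ Fin.≟ zero) →-dec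
  + 4 ∣? (+ toℕ r₁ + (+ toℕ r₂ + (+ toℕ r₃ + 0ℤ)) - 0ℤ) →-dec
  length (filter ≡2? (r₁ ∷ r₂ ∷ r₃ ∷ [])) ℕ.≟ 1)

module _ {n} {P : Fin n → Set} (P? : ∀ i → Dec (P i)) where

  ∈-tabulate⁺ : ∀ {i} → P i → i Subset.∈ tabulate (does ∘ P?)
  ∈-tabulate⁺ {i} p = lookup⇒[]= i _ (trans (lookup∘tabulate (does ∘ P?) i) (dec-true (P? i) p))

  ∈-tabulate⁻ : ∀ {i} → i Subset.∈ tabulate (does ∘ P?) → P i
  ∈-tabulate⁻ {i} i∈ with P? i | trans (sym (lookup∘tabulate (does ∘ P?) i)) ([]=⇒lookup i∈)
  -- The case `no` would make `false` equal to `true`.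
  ... | yes p | _ = p

-- Moves the count from edges to their residues, where the finite check applies.
length-filter-map : ∀ {A B : Set} {P : B → Set} (P? : ∀ y → Dec (P y)) (f : A → B) xs →
  length (filter (P? ∘ f) xs) ≡ length (filter P? (map f xs))
length-filter-map P? f [] = refl
length-filter-map P? f (x ∷ xs) with does (P? (f x))
... | true  = cong suc (length-filter-map P? f xs)
... | false = length-filter-map P? f xs

ℤ₄-magic⇒oneFactor : ∀ G → Cubic G → ZeroSumMagic (ℤmod 4 ^ 1) G → HasOneFactor G
ℤ₄-magic⇒oneFactor G cubic (φ , φ≉0 , φ-sum) = tabulate (does ∘ two?) , λ v →
  trans (cong length (filter-≐ (Subset._∈? tabulate (does ∘ two?)) two?
          (∈-tabulate⁻ two? , ∈-tabulate⁺ two?) (edgesAt G v)))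
    (trans (length-filter-map ≡2? ρ (edgesAt G v))
      (count (edgesAt G v) (cubic v) (φ-sum v zero)))
  where
  ρ : Edge G → Fin 4
  ρ e = residue (φ e zero)

  two? : ∀ e → Dec (ρ e ≡ 2F)
  two? = ≡2? ∘ ρ

  ρ≢0 : ∀ e → ρ e ≢ zero
  ρ≢0 e ρ≡0 = φ≉0 e λ { zero → subst (λ r → φ e zero ℤ₄.≈ + toℕ r) ρ≡0 (residue-≈ (φ e zero)) }

  count : ∀ es → length es ≡ 3 →
    foldr (AbelianGroup._∙_ (ℤmod 4 ^ 1)) (AbelianGroup.ε (ℤmod 4 ^ 1)) (map φ es) zero ℤ₄.≈ 0ℤ →
    length (filter ≡2? (map ρ es)) ≡ 1
  count (e₁ ∷ e₂ ∷ e₃ ∷ []) refl sum≈0 =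
    residues-one-2 (ρ e₁) (ρ e₂) (ρ e₃) (ρ≢0 e₁) (ρ≢0 e₂) (ρ≢0 e₃)
      (ℤ₄.trans {ρ-sum} {φ-sum′} {0ℤ} (ℤ₄.sym {φ-sum′} {ρ-sum} φ≈ρ) sum≈0)
    where
    φ-sum′ ρ-sum : ℤ
    φ-sum′ = φ e₁ zero + (φ e₂ zero + (φ e₃ zero + 0ℤ))
    ρ-sum  = + toℕ (ρ e₁) + (+ toℕ (ρ e₂) + (+ toℕ (ρ e₃) + 0ℤ))

    step : ∀ e {x y} → x ℤ₄.≈ y → φ e zero + x ℤ₄.≈ + toℕ (ρ e) + y
    step e {x} {y} = ℤ₄.∙-cong {φ e zero} {+ toℕ (ρ e)} {x} {y} (residue-≈ (φ e zero))

    φ≈ρ : φ-sum′ ℤ₄.≈ ρ-sum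
    φ≈ρ = step e₁ {φ e₂ zero + (φ e₃ zero + 0ℤ)} {+ toℕ (ρ e₂) + (+ toℕ (ρ e₃) + 0ℤ)}
      (step e₂ {φ e₃ zero + 0ℤ} {+ toℕ (ρ e₃) + 0ℤ} (step e₃ {0ℤ} {0ℤ} (ℤ₄.refl {0ℤ})))

-- The value of ζ₄.

theorem4p3 : (G : Graph) → Cubic G →
    (HasOneFactor G → Zeta 2 G [ 1 ]) × (¬ HasOneFactor G → Zeta 2 G [ 2 ])
theorem4p3 G cubic =
    (λ factor → ℕ.≤-refl , oneFactor⇒ℤ₄-magic G cubic factor , λ _ 1≤d _ → 1≤d)
  , (λ noFactor → s≤s z≤n , cubic⇒ℤ₄²-magic G cubic , minimal noFactor)
  where
  -- Only `d = 1` has to be excluded, and there a labelling would produce a 1-factor.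
  minimal : ¬ HasOneFactor G → ∀ d → 1 ≤ d → ZeroSumMagic (ℤmod 4 ^ d) G → 2 ≤ d
  minimal noFactor 1 _ magic = contradiction (ℤ₄-magic⇒oneFactor G cubic magic) noFactor
  minimal noFactor (suc (suc d)) _ _ = s≤s (s≤s z≤n)
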